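{- If $G$ is a connected split graph different from $K_2$, then $\operatorname{lir}(^2G)\leq 2$.
   Context: All graphs are finite and without loops. A simple graph $G$ is a split graph if its vertex set has a partition $\{X,Y\}$ such that $G[X]$ is a complete graph and $Y$ is an independent set. A multigraph $M$ consists of a nonempty finite vertex set and a multiset of edges (2-element subsets of the vertex set); the degree of a vertex is the sum of the multiplicities of the edges incident to it. For a simple graph $G$, $^2G$ denotes the 2-multigraph obtained from $G$ by replacing each edge of $G$ with two parallel edges. A multigraph is locally irregular if every two adjacent vertices have different degrees. An edge coloring of a multigraph $M$ assigns a color to each element of the edge multiset (it need not be proper, and parallel edges may receive different colors); it is locally irregular if, for each color, the submultigraph of $M$ induced by the edges of that color is locally irregular. The locally irregular chromatic index $\operatorname{lir}(M)$ is the smallest number of colors in a locally irregular edge coloring of $M$, if one exists; so $\operatorname{lir}(M)\leq k$ means that $M$ has a locally irregular edge coloring using at most $k$ colors. -}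

module Defs where

import Algebra.Properties.CommutativeMonoid.Sum
open import Data.Bool.Base using (if_then_else_)
open import Data.Fin.Base using (Fin; cast)
open import Data.Fin.Properties using (_≟_; cast-is-id)
open import Data.Fin.Subset using (Subset; _∈_; ∁)
open import Data.Nat.Base as ℕ using (ℕ; NonZero; nonZero; _<_)
open import Data.Nat.Properties using (+-0-commutativeMonoid; n≤0⇒n≡0)
open import Data.Product.Base using (Σ-syntax; _×_)
open import Data.Vec.Base using (count; tabulate)
open import Data.Vec.Properties using (count≤n; tabulate-cong)
open import Function.Bundles using (_↔_; _⇔_; module Inverse)
open import Level using (0ℓ)
open import Relation.Binary.Construct.Closure.ReflexiveTransitive using (Star)
open import Relation.Binary.Core using (Rel)
open import Relation.Binary.Definitions using (Decidable; Symmetric)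
open import Relation.Binary.PropositionalEquality
  using (_≡_; _≢_; refl; sym; trans; cong; subst; ≢-sym)
open import Relation.Nullary using (¬_; does; yes; no; contradiction)
open import Relation.Nullary.Decidable using (¬?)

open Algebra.Properties.CommutativeMonoid.Sum +-0-commutativeMonoid using (sum)

record SimpleGraph (n : ℕ) : Set₁ where
  infix 4 _~_ _~?_
  field
    nonempty : NonZero n
    _~_      : Rel (Fin n) 0ℓ
    _~?_     : Decidable _~_
    ~-sym    : Symmetric _~_
    ~-irrefl : ∀ u → ¬ (u ~ u)

  IsClique : Subset n → Set
  IsClique X = ∀ u v → u ∈ X → v ∈ X → u ≢ v → u ~ v

  IsIndependent : Subset n → Set
  IsIndependent Y = ∀ u v → u ∈ Y → v ∈ Y → ¬ (u ~ v)

  -- Either part of the partition {X , ∁ X} may be empty.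
  IsSplit : Set
  IsSplit = Σ[ X ∈ Subset n ] (IsClique X × IsIndependent (∁ X))

  Connected : Set
  Connected = ∀ u v → Star _~_ u v

open SimpleGraph public using (IsSplit; Connected)

infix 4 _≅_

_≅_ : ∀ {m n} → SimpleGraph m → SimpleGraph n → Set
_≅_ {m} {n} G H =
  Σ[ f ∈ (Fin m ↔ Fin n) ]
    (∀ u v → (u G.~ v) ⇔ (Inverse.to f u H.~ Inverse.to f v))
  where
    module G = SimpleGraph G
    module H = SimpleGraph H

K : ∀ n → {{NonZero n}} → SimpleGraph n
K n {{n≢0}} = record
  { nonempty = n≢0
  ; _~_      = _≢_
  ; _~?_     = λ u v → ¬? (u ≟ v)
  ; ~-sym    = ≢-sym
  ; ~-irrefl = λ _ u≢u → u≢u refl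
  }

K₂ : SimpleGraph 2
K₂ = K 2

-- A multiset of 2-element subsets of Fin n, given by its multiplicity
-- function: mult u v is the multiplicity of {u , v}.
record Multigraph (n : ℕ) : Set where
  field
    nonempty  : NonZero n
    mult      : Fin n → Fin n → ℕ
    mult-sym  : ∀ u v → mult u v ≡ mult v u
    mult-loop : ∀ u → mult u u ≡ 0

  Adjacent : Fin n → Fin n → Set
  Adjacent u v = 0 < mult u v

  degree : Fin n → ℕ
  degree u = sum (mult u)

  LocallyIrregular : Set
  LocallyIrregular = ∀ u v → Adjacent u v → degree u ≢ degree v

infix 25 ²_

²_ : ∀ {n} → SimpleGraph n → Multigraph n
²_ {n} G = record
  { nonempty  = nonempty
  ; mult      = twice
  ; mult-sym  = twice-sym
  ; mult-loop = twice-loop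
  }
  where
    open SimpleGraph G

    twice : Fin n → Fin n → ℕ
    twice u v = if does (u ~? v) then 2 else 0

    twice-sym : ∀ u v → twice u v ≡ twice v u
    twice-sym u v with u ~? v | v ~? u
    ... | yes _   | yes _   = refl
    ... | no _    | no _    = refl
    ... | yes u~v | no ¬v~u = contradiction (~-sym u~v) ¬v~u
    ... | no ¬u~v | yes v~u = contradiction (~-sym v~u) ¬u~v

    twice-loop : ∀ u → twice u u ≡ 0
    twice-loop u with u ~? u
    ... | yes u~u = contradiction u~u (~-irrefl u)
    ... | no _    = refl

-- The elements of the edge multiset joining u and v are the i : Fin (mult u v);
-- the i-th one seen from u is the i-th one seen from v, hence colour-sym.
record EdgeColouring {n} (M : Multigraph n) (k : ℕ) : Set where
  open Multigraph M
  field
    colour     : ∀ u v → Fin (mult u v) → Fin k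
    colour-sym : ∀ u v i → colour v u (cast (mult-sym u v) i) ≡ colour u v i

  -- Vertices not incident to an edge of colour a are kept; being isolated,
  -- they do not affect local irregularity.
  colourClass : Fin k → Multigraph n
  colourClass a = record
    { nonempty  = nonempty
    ; mult      = multₐ
    ; mult-sym  = λ u v → count-cast (mult-sym u v) (colour u v) (colour v u) (colour-sym u v)
    ; mult-loop = λ u → n≤0⇒n≡0
        (subst (multₐ u u ℕ.≤_) (mult-loop u)
          (count≤n (_≟ a) (tabulate (colour u u))))
    }
    where
      multₐ : Fin n → Fin n → ℕ
      multₐ u v = count (_≟ a) (tabulate (colour u v))

      count-cast : ∀ {p q} (p≡q : p ≡ q) (f : Fin p → Fin k) (g : Fin q → Fin k) →
                   (∀ i → g (cast p≡q i) ≡ f i) →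
                   count (_≟ a) (tabulate f) ≡ count (_≟ a) (tabulate g)
      count-cast refl f g g≗f = cong (count (_≟ a)) (tabulate-cong λ i →
        trans (sym (g≗f i)) (cong g (cast-is-id refl i)))

  IsLocallyIrregular : Set
  IsLocallyIrregular = ∀ a → Multigraph.LocallyIrregular (colourClass a)

infix 4 lir_≤_

lir_≤_ : ∀ {n} → Multigraph n → ℕ → Set
lir M ≤ k = Σ[ c ∈ EdgeColouring M k ] EdgeColouring.IsLocallyIrregular c

{-# OPTIONS --safe #-}
module Submission where

-- Let X be the clique, k = |X|, and let h(x) be the number of neighbours of x outside X.  For k ≥ 3
-- the clique is coloured so that the red degrees s(x) inside X increase with h: peel off a vertex b
-- of largest h and a vertex a of smallest h, colour ²(X \ {a , b}) recursively, join b to the inner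
-- vertices in red and a to them in blue, and give the edge ab one copy of each colour.  When k is
-- odd, this leaves a single vertex m, whose degree s(m) is even while all the others are odd; when k
-- is even, first remove one vertex of largest h and join it to the rest in red.  The edges between
-- m and the complement of X are then coloured blue and all other edges leaving X red.  Two clique
-- vertices are separated by monotonicity; an outer vertex y has even red degree, at most 2(k - 1)
-- since m is not counted, and blue degree at most 2, which separates it from its neighbours.
-- For k = 2 a single red and blue edge on X works if both vertices have neighbours outside X; in the
-- remaining cases G is a star and everything is coloured red.

open import Defs
import Algebra.Properties.Semiring.Sum as Sum
open import Data.Bool.Base using (Bool; true; false; not; if_then_else_)
open import Data.Bool.Properties using () renaming (_≟_ to _≟ᵇ_)
open import Data.Fin.Base using (Fin; zero; suc; cast)
open import Data.Fin.Properties using (_≟_; any?; cast-is-id)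
open import Data.Fin.Subset.Properties using (x∉p⇒x∈∁p)
open import Data.List.Base using (allFin; filter)
open import Data.List.Extrema.Nat
  using (argmin; argmax; argmin-all; argmax-all; f[argmin]≤f[xs]; f[xs]≤f[argmax])
open import Data.List.Membership.Propositional.Properties using (∈-filter⁺; ∈-allFin)
open import Data.List.Relation.Unary.All using (lookup)
open import Data.List.Relation.Unary.All.Properties using (all-filter)
open import Data.Nat.Base
open import Data.Nat.Properties renaming (_≟_ to _≟ⁿ_)
open import Data.Nat.Tactic.RingSolver using (solve-∀)
open import Data.Product.Base using (∃-syntax; _×_; _,_; proj₁; proj₂)
open import Data.Sum.Base using (_⊎_; inj₁; inj₂; [_,_]′) renaming (swap to ⊎-swap)
open import Data.Vec.Base as Vec using (count; tabulate)
open import Data.Vec.Properties using ([]=⇒lookup; lookup⇒[]=)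
open import Function.Base using (_∘_; case_of_)
open import Function.Bundles using (mk⇔; mk↔ₛ′)
open import Relation.Binary.Construct.Closure.ReflexiveTransitive using (Star; ε; _◅_)
open import Relation.Binary.PropositionalEquality
open import Relation.Nullary using (¬_; does; yes; no; contradiction)
open import Relation.Nullary.Decidable using (dec-true; dec-false; ¬?; _×-dec_)

open Sum +-*-semiring using (sum; sum-cong-≗; ∑-distrib-+; *-distribˡ-sum; sum-replicate-zero)

-- Arithmetic identities, finite sums and extremal members of a vertex set.

2i+2≡2[1+i] : ∀ i → 2 * i + 2 ≡ 2 * suc i
2i+2≡2[1+i] = solve-∀

4i+2≡2[1+2i] : ∀ i → 4 * i + 2 ≡ 2 * suc (2 * i)
4i+2≡2[1+2i] = solve-∀

x+y+z≡x+z+y : ∀ x y z → x + y + z ≡ x + z + y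
x+y+z≡x+z+y = solve-∀

⟦_⟧ : Bool → ℕ
⟦ b ⟧ = if b then 1 else 0

module _ {n : ℕ} where

  size : (Fin n → Bool) → ℕ
  size X = sum (λ u → ⟦ X u ⟧)

  δ : Fin n → Fin n → ℕ
  δ a v = ⟦ does (a ≟ v) ⟧

  δ-refl : ∀ a → δ a a ≡ 1
  δ-refl a = cong ⟦_⟧ (dec-true (a ≟ a) refl)

  δ-≢ : ∀ {a v} → a ≢ v → δ a v ≡ 0
  δ-≢ {a} {v} a≢v = cong ⟦_⟧ (dec-false (a ≟ v) a≢v)

  sum-zero : ∀ {f : Fin n → ℕ} → (∀ u → f u ≡ 0) → sum f ≡ 0
  sum-zero f≗0 = trans (sum-cong-≗ f≗0) (sum-replicate-zero n)

sum-δ : ∀ {n} (a : Fin n) → sum (δ a) ≡ 1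
sum-δ {suc n} zero    = cong suc (sum-zero {n} λ _ → refl)
sum-δ {suc n} (suc a) = sum-δ a

sum-≤ : ∀ {n} {f g : Fin n → ℕ} → (∀ u → f u ≤ g u) → sum f ≤ sum g
sum-≤ {zero}  f≤g = z≤n
sum-≤ {suc n} f≤g = +-mono-≤ (f≤g zero) (sum-≤ (f≤g ∘ suc))

term≤sum : ∀ {n} (f : Fin n → ℕ) u → f u ≤ sum f
term≤sum f zero    = m≤m+n _ _
term≤sum f (suc u) = m≤n⇒m≤o+n (f zero) (term≤sum (f ∘ suc) u)

module _ {n : ℕ} where

  sum-linear : ∀ a b (f g : Fin n → ℕ) → sum (λ v → a * f v + b * g v) ≡ a * sum f + b * sum g
  sum-linear a b f g = trans (∑-distrib-+ (λ v → a * f v) (λ v → b * g v))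
    (sym (cong₂ _+_ (*-distribˡ-sum a f) (*-distribˡ-sum b g)))

  member : ∀ {X : Fin n → Bool} {k} → size X ≡ suc k → ∃[ a ] X a ≡ true
  member {X} |X|≡1+k with any? (λ a → X a ≟ᵇ true)
  ... | yes a∈X = a∈X
  ... | no ∄    = contradiction (trans (sym |X|≡1+k) (sum-zero X≗0)) λ ()
    where
    X≗0 : ∀ u → ⟦ X u ⟧ ≡ 0
    X≗0 u with X u in u∈X
    ... | true  = contradiction (u , u∈X) ∄
    ... | false = refl

  module _ (h : Fin n → ℕ) {X : Fin n → Bool} {k : ℕ} (|X|≡1+k : size X ≡ suc k) where
    private
      a₀ = proj₁ (member |X|≡1+k)
      a₀∈X = proj₂ (member |X|≡1+k)
      X? = λ u → X u ≟ᵇ true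
      xs = filter X? (allFin n)

    least : ∃[ a ] (X a ≡ true × ∀ u → X u ≡ true → h a ≤ h u)
    least = argmin h a₀ xs , argmin-all h {P = λ u → X u ≡ true} a₀∈X (all-filter X? (allFin n)) ,
      λ u u∈X → lookup (f[argmin]≤f[xs] {f = h} a₀ xs) (∈-filter⁺ X? (∈-allFin u) u∈X)

    greatest : ∃[ b ] (X b ≡ true × ∀ u → X u ≡ true → h u ≤ h b)
    greatest = argmax h a₀ xs , argmax-all h {P = λ u → X u ≡ true} a₀∈X (all-filter X? (allFin n)) ,
      λ u u∈X → lookup (f[xs]≤f[argmax] {f = h} a₀ xs) (∈-filter⁺ X? (∈-allFin u) u∈X)

-- The function that agrees with `f` at `u` and `v` and vanishes elsewhere lies pointwise below `f`.
-- As a combination of `δ u` and `δ v` it sums to the left side, and `u ≢ v` prevents both terms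
-- from falling on the same index.
two-terms≤sum : ∀ {n} (f : Fin n → ℕ) {u v} → u ≢ v → f u + f v ≤ sum f
two-terms≤sum f {u} {v} u≢v = begin
  f u + f v                               ≡⟨ cong₂ _+_ (*-identityʳ (f u)) (*-identityʳ (f v)) ⟨
  f u * 1 + f v * 1                       ≡⟨ cong₂ (λ i j → f u * i + f v * j) (sum-δ u) (sum-δ v) ⟨
  f u * sum (δ u) + f v * sum (δ v)       ≡⟨ sum-linear (f u) (f v) (δ u) (δ v) ⟨
  sum (λ x → f u * δ u x + f v * δ v x)   ≤⟨ sum-≤ pointwise ⟩
  sum f                                   ∎
  where
  open ≤-Reasoning
  pointwise : ∀ x → f u * δ u x + f v * δ v x ≤ f x
  pointwise x with u ≟ x | v ≟ x
  ... | yes refl | yes refl = contradiction refl u≢v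
  ... | yes refl | no _     = ≤-reflexive (trans (cong₂ _+_ (*-identityʳ (f u)) (*-zeroʳ (f v)))
                                            (+-identityʳ (f u)))
  ... | no _     | yes refl = ≤-reflexive (cong₂ _+_ (*-zeroʳ (f u)) (*-identityʳ (f v)))
  ... | no _     | no _     = ≤-trans (≤-reflexive (cong₂ _+_ (*-zeroʳ (f u)) (*-zeroʳ (f v)))) z≤n

singleton-unique : ∀ {n} {X : Fin n → Bool} {u v} → size X ≡ 1 → X u ≡ true → X v ≡ true → u ≡ v
singleton-unique {X = X} {u} {v} |X|≡1 u∈X v∈X with u ≟ v
... | yes u≡v = u≡v
... | no u≢v  = contradiction (subst₂ (λ i j → ⟦ i ⟧ + ⟦ j ⟧ ≤ 1) u∈X v∈X
                  (subst (⟦ X u ⟧ + ⟦ X v ⟧ ≤_) |X|≡1 (two-terms≤sum (λ x → ⟦ X x ⟧) u≢v))) λ { (s≤s ()) }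

-- Red weightings of a clique and chains of its vertices.

-- w u v is the number of red copies of the edge uv of the doubled clique on X, so s u is the red
-- degree of u inside X.
record Weighting {n} (X : Fin n → Bool) : Set where
  field
    w      : Fin n → Fin n → ℕ
    w-sym  : ∀ u v → w u v ≡ w v u
    w≤2    : ∀ u v → w u v ≤ 2
    w-diag : ∀ u → w u u ≡ 0
    w-supp : ∀ {u} v → X u ≡ false → w u v ≡ 0

  s : Fin n → ℕ
  s u = sum (w u)

module _ {n} {X : Fin n → Bool} (h : Fin n → ℕ) (W : Weighting X) (m : Fin n) where
  open Weighting W

  infix 4 _⊏_

  -- Edges from m go up in red only and down in blue only.  Hence recolouring edges that leave X
  -- at m, which lowers its red degree and raises its blue one, keeps m apart from its
  -- neighbours above.
  record _⊏_ (u v : Fin n) : Set where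
    field
      s<     : s u < s v
      h≤     : h u ≤ h v
      from-m : u ≡ m → w u v ≡ 2
      to-m   : v ≡ m → w u v ≡ 0

  IsChain : Set
  IsChain = ∀ {u v} → X u ≡ true → X v ≡ true → u ≢ v → u ⊏ v ⊎ v ⊏ u

-- Extending a weighting by a top vertex and pendant vertices.

data Role : Set where
  top inner pendant outside : Role

inner? : Role → Bool
inner? inner = true
inner? _     = false

-- One construction serves both kinds of growth: with `E` empty it adds `b` alone (`Without`), and
-- with `E` a single vertex `a` it adds both ends of the chain at once (`Ends`).
module Extend {n} (X : Fin n → Bool) (b : Fin n) (b∈X : X b ≡ true)
  (E : Fin n → Bool) (E⊆X : ∀ {u} → E u ≡ true → X u ≡ true × b ≢ u) where

  role : Fin n → Role
  role u = if does (b ≟ u) then top else if E u then pendant else if X u then inner else outside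

  X° : Fin n → Bool
  X° u = inner? (role u)

  -- Each constructor also records the values of `δ b`, `E` and `X` at `u`, so that the pointwise
  -- identities behind the degree sums compute after a match on the role.
  data RoleView (u : Fin n) : Role → Set where
    top     : b ≡ u → δ b u ≡ 1 → E u ≡ false → X u ≡ true → RoleView u top
    inner   : b ≢ u → δ b u ≡ 0 → E u ≡ false → X u ≡ true → RoleView u inner
    pendant : b ≢ u → δ b u ≡ 0 → E u ≡ true → X u ≡ true → RoleView u pendant
    outside : b ≢ u → δ b u ≡ 0 → E u ≡ false → X u ≡ false → RoleView u outside

  roleView : ∀ u → RoleView u (role u)
  roleView u with b ≟ u | E u in e | X u in x
  ... | yes refl | false | true  = top refl (δ-refl b) e x
  ... | yes refl | false | false = contradiction (trans (sym b∈X) x) λ ()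
  ... | yes refl | true  | _     = contradiction refl (proj₂ (E⊆X e))
  ... | no b≢u   | true  | true  = pendant b≢u (δ-≢ b≢u) e x
  ... | no b≢u   | true  | false = contradiction (trans (sym (proj₁ (E⊆X e))) x) λ ()
  ... | no b≢u   | false | true  = inner b≢u (δ-≢ b≢u) e x
  ... | no b≢u   | false | false = outside b≢u (δ-≢ b≢u) e x

  inner⁻ : ∀ {u} → X° u ≡ true → role u ≡ inner
  inner⁻ {u} u∈X° with role u
  ... | inner = refl

  X°⊆X : ∀ {u} → X° u ≡ true → X u ≡ true
  X°⊆X {u} u∈X° with role u | roleView u
  ... | .inner | inner _ _ _ u∈X = u∈X

  pendant⁻ : ∀ {u} → role u ≡ pendant → E u ≡ true
  pendant⁻ {u} u-pendant with role u | roleView u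
  ... | .pendant | pendant _ _ u∈E _ = u∈E

  role-top : role b ≡ top
  role-top rewrite dec-true (b ≟ b) refl = refl

  member-role : ∀ {u} → X u ≡ true → b ≡ u ⊎ role u ≡ inner ⊎ role u ≡ pendant
  member-role {u} u∈X with role u | roleView u
  ... | .top     | top b≡u _ _ _       = inj₁ b≡u
  ... | .inner   | inner _ _ _ _       = inj₂ (inj₁ refl)
  ... | .pendant | pendant _ _ _ _     = inj₂ (inj₂ refl)
  ... | .outside | outside _ _ _ u∉X   = contradiction (trans (sym u∈X) u∉X) λ ()

  size-split : size X ≡ suc (size E + size X°)
  size-split = begin
    size X                                             ≡⟨ sum-cong-≗ pointwise ⟩
    sum (λ u → δ b u + (⟦ E u ⟧ + ⟦ X° u ⟧))           ≡⟨ ∑-distrib-+ (δ b) (λ u → ⟦ E u ⟧ + ⟦ X° u ⟧) ⟩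
    sum (δ b) + sum (λ u → ⟦ E u ⟧ + ⟦ X° u ⟧)         ≡⟨ cong₂ _+_ (sum-δ b)
                                                            (∑-distrib-+ (λ u → ⟦ E u ⟧) (λ u → ⟦ X° u ⟧)) ⟩
    suc (size E + size X°)                             ∎
    where
    open ≡-Reasoning
    pointwise : ∀ u → ⟦ X u ⟧ ≡ δ b u + (⟦ E u ⟧ + ⟦ X° u ⟧)
    pointwise u with role u | roleView u
    ... | .top     | top     _ d e x rewrite d | e | x = refl
    ... | .inner   | inner   _ d e x rewrite d | e | x = refl
    ... | .pendant | pendant _ d e x rewrite d | e | x = refl
    ... | .outside | outside _ d e x rewrite d | e | x = refl

  module _ (W° : Weighting X°) where
    open Weighting W°

    -- The value 1 between `top` and `pendant` is the source of odd red degrees: with a single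
    -- pendant vertex both ends become odd. The value 2 shifts all inner degrees by the same even
    -- amount, so their order and parity survive. Between a pendant and an inner vertex both copies
    -- stay blue.
    weight : Role → Role → ℕ → ℕ
    weight top     inner   _ = 2
    weight inner   top     _ = 2
    weight top     pendant _ = 1
    weight pendant top     _ = 1
    weight inner   inner   x = x
    weight _       _       _ = 0

    extended : Weighting X
    extended = record
      { w      = λ u v → weight (role u) (role v) (w u v)
      ; w-sym  = λ u v → weight-sym (role u) (role v) (w-sym u v)
      ; w≤2    = λ u v → weight≤2 (role u) (role v) (w≤2 u v)
      ; w-diag = λ u → weight-diag (role u) (w-diag u)
      ; w-supp = λ {u} v → weight-supp u (role v)
      }
      where
      weight-sym : ∀ ρ σ {x y} → x ≡ y → weight ρ σ x ≡ weight σ ρ y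
      weight-sym top     top     _ = refl
      weight-sym top     inner   _ = refl
      weight-sym top     pendant _ = refl
      weight-sym top     outside _ = refl
      weight-sym inner   top     _ = refl
      weight-sym inner   inner   p = p
      weight-sym inner   pendant _ = refl
      weight-sym inner   outside _ = refl
      weight-sym pendant top     _ = refl
      weight-sym pendant inner   _ = refl
      weight-sym pendant pendant _ = refl
      weight-sym pendant outside _ = refl
      weight-sym outside top     _ = refl
      weight-sym outside inner   _ = refl
      weight-sym outside pendant _ = refl
      weight-sym outside outside _ = refl

      weight≤2 : ∀ ρ σ {x} → x ≤ 2 → weight ρ σ x ≤ 2
      weight≤2 top     top     _ = z≤n
      weight≤2 top     inner   _ = ≤-refl
      weight≤2 top     pendant _ = s≤s z≤n
      weight≤2 top     outside _ = z≤n
      weight≤2 inner   top     _ = ≤-refl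
      weight≤2 inner   inner   p = p
      weight≤2 inner   pendant _ = z≤n
      weight≤2 inner   outside _ = z≤n
      weight≤2 pendant top     _ = s≤s z≤n
      weight≤2 pendant inner   _ = z≤n
      weight≤2 pendant pendant _ = z≤n
      weight≤2 pendant outside _ = z≤n
      weight≤2 outside _       _ = z≤n

      weight-diag : ∀ ρ {x} → x ≡ 0 → weight ρ ρ x ≡ 0
      weight-diag top     _ = refl
      weight-diag inner   p = p
      weight-diag pendant _ = refl
      weight-diag outside _ = refl

      weight-supp : ∀ u σ {x} → X u ≡ false → weight (role u) σ x ≡ 0
      weight-supp u σ u∉X with role u | roleView u
      ... | .top     | top     _ _ _ u∈X = contradiction (trans (sym u∈X) u∉X) λ ()
      ... | .inner   | inner   _ _ _ u∈X = contradiction (trans (sym u∈X) u∉X) λ ()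
      ... | .pendant | pendant _ _ _ u∈X = contradiction (trans (sym u∈X) u∉X) λ ()
      ... | .outside | outside _ _ _ _   = refl

    open Weighting extended using () renaming (w to w′; s to s′)

    s-top : s′ b ≡ 2 * size X° + 1 * size E
    s-top = trans (sum-cong-≗ pointwise) (sum-linear 2 1 (λ v → ⟦ X° v ⟧) (λ v → ⟦ E v ⟧))
      where
      pointwise : ∀ v → w′ b v ≡ 2 * ⟦ X° v ⟧ + 1 * ⟦ E v ⟧
      pointwise v rewrite role-top with role v | roleView v
      ... | .top     | top     _ _ e _ rewrite e = refl
      ... | .inner   | inner   _ _ e _ rewrite e = refl
      ... | .pendant | pendant _ _ e _ rewrite e = refl
      ... | .outside | outside _ _ e _ rewrite e = refl

    s-inner : ∀ {u} → role u ≡ inner → s′ u ≡ s u + 2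
    s-inner {u} u-inner = begin
      s′ u                            ≡⟨ sum-cong-≗ pointwise ⟩
      sum (λ v → 1 * w u v + 2 * δ b v) ≡⟨ sum-linear 1 2 (w u) (δ b) ⟩
      1 * s u + 2 * sum (δ b)         ≡⟨ cong₂ _+_ (*-identityˡ (s u)) (cong (2 *_) (sum-δ b)) ⟩
      s u + 2                         ∎
      where
      open ≡-Reasoning
      zero-outside : ∀ v → X° v ≡ false → w u v ≡ 0
      zero-outside v v∉X° = trans (w-sym u v) (w-supp u v∉X°)

      pointwise : ∀ v → w′ u v ≡ 1 * w u v + 2 * δ b v
      pointwise v rewrite u-inner with role v | roleView v | zero-outside v
      ... | .top     | top     _ d _ _ | w≡0 rewrite d | w≡0 refl = refl
      ... | .inner   | inner   _ d _ _ | _   rewrite d            = sym (trans (+-identityʳ _) (*-identityˡ _))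
      ... | .pendant | pendant _ d _ _ | w≡0 rewrite d | w≡0 refl = refl
      ... | .outside | outside _ d _ _ | w≡0 rewrite d | w≡0 refl = refl

    s-pendant : ∀ {u} → role u ≡ pendant → s′ u ≡ 1
    s-pendant {u} u-pendant = trans (sum-cong-≗ pointwise) (sum-δ b)
      where
      pointwise : ∀ v → w′ u v ≡ δ b v
      pointwise v rewrite u-pendant with role v | roleView v
      ... | .top     | top     _ d _ _ rewrite d = refl
      ... | .inner   | inner   _ d _ _ rewrite d = refl
      ... | .pendant | pendant _ d _ _ rewrite d = refl
      ... | .outside | outside _ d _ _ rewrite d = refl

    module _ (h : Fin n → ℕ) (m : Fin n) (m-inner : role m ≡ inner)
      (h≤top : ∀ u → X u ≡ true → h u ≤ h b)
      (pendant≤h : ∀ {u} → E u ≡ true → ∀ v → X v ≡ true → h u ≤ h v)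
      (E-unique : ∀ {u v} → E u ≡ true → E v ≡ true → u ≡ v)
      (s<top : ∀ {u} → role u ≡ inner → s u + 2 < s′ b)
      (chain : IsChain h W° m) where

      private
        infix 4 _⊏°_ _⊏′_
        _⊏°_ = _⊏_ h W° m
        _⊏′_ = _⊏_ h extended m

        not-m : ∀ {u ρ} → role u ≡ ρ → ρ ≢ inner → u ≢ m
        not-m role-u ρ≢inner refl = ρ≢inner (trans (sym role-u) m-inner)

        inner⊏top : ∀ {u} → role u ≡ inner → X u ≡ true → u ⊏′ b
        inner⊏top {u} u-inner u∈X = record
          { s<     = subst (_< s′ b) (sym (s-inner u-inner)) (s<top u-inner)
          ; h≤     = h≤top u u∈X
          ; from-m = λ _ → cong₂ (λ ρ σ → weight ρ σ (w u b)) u-inner role-top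
          ; to-m   = λ b≡m → contradiction b≡m (not-m role-top λ ())
          }

        pendant⊏inner : ∀ {u v} → role u ≡ pendant → E u ≡ true → role v ≡ inner → X v ≡ true → u ⊏′ v
        pendant⊏inner {u} {v} u-pendant u∈E v-inner v∈X = record
          { s<     = subst₂ _<_ (sym (s-pendant u-pendant)) (sym (s-inner v-inner)) (m≤n+m 2 (s v))
          ; h≤     = pendant≤h u∈E v v∈X
          ; from-m = λ u≡m → contradiction u≡m (not-m u-pendant λ ())
          ; to-m   = λ _ → cong₂ (λ ρ σ → weight ρ σ (w u v)) u-pendant v-inner
          }

        pendant⊏top : ∀ {u} → role u ≡ pendant → E u ≡ true → u ⊏′ b
        pendant⊏top {u} u-pendant u∈E = record
          -- `m` is used here merely as some inner vertex: `2 ≤ s m + 2 < s′ b`.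
          { s<     = subst (_< s′ b) (sym (s-pendant u-pendant))
                       (≤-trans (m≤n+m 2 (s m)) (<⇒≤ (s<top m-inner)))
          ; h≤     = pendant≤h u∈E b b∈X
          ; from-m = λ u≡m → contradiction u≡m (not-m u-pendant λ ())
          ; to-m   = λ b≡m → contradiction b≡m (not-m role-top λ ())
          }

        inner⊏inner : ∀ {u v} → role u ≡ inner → role v ≡ inner → u ⊏° v → u ⊏′ v
        inner⊏inner {u} {v} u-inner v-inner u⊏v = record
          { s<     = subst₂ _<_ (sym (s-inner u-inner)) (sym (s-inner v-inner)) (+-monoˡ-< 2 s<)
          ; h≤     = h≤
          ; from-m = λ u≡m → trans w′≡w (from-m u≡m)
          ; to-m   = λ v≡m → trans w′≡w (to-m v≡m)
          }
          where
          open _⊏_ u⊏v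
          w′≡w : w′ u v ≡ w u v
          w′≡w = cong₂ (λ ρ σ → weight ρ σ (w u v)) u-inner v-inner

      -- The new order is pendant, inner vertices in their old order, `b`. Inner red degrees rise by
      -- 2, hence exceed the degree 1 of a pendant, and `s<top` keeps them below that of `b`. Since
      -- `m` is inner, its edge to `b` is all red and its edge to a pendant all blue.
      extended-chain : IsChain h extended m
      extended-chain {u} {v} u∈X v∈X u≢v with role u in ρ | role v in σ | roleView u | roleView v
      ... | _ | _ | outside _ _ _ u∉X | _ = contradiction (trans (sym u∈X) u∉X) λ ()
      ... | _ | _ | _ | outside _ _ _ v∉X = contradiction (trans (sym v∈X) v∉X) λ ()
      ... | _ | _ | top refl _ _ _ | top refl _ _ _ = contradiction refl u≢v
      ... | _ | _ | top refl _ _ _ | inner _ _ _ _ = inj₂ (inner⊏top σ v∈X)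
      ... | _ | _ | top refl _ _ _ | pendant _ _ e _ = inj₂ (pendant⊏top σ e)
      ... | _ | _ | inner _ _ _ _ | top refl _ _ _ = inj₁ (inner⊏top ρ u∈X)
      ... | _ | _ | pendant _ _ e _ | top refl _ _ _ = inj₁ (pendant⊏top ρ e)
      ... | _ | _ | inner _ _ _ _ | pendant _ _ e _ = inj₂ (pendant⊏inner σ e ρ u∈X)
      ... | _ | _ | pendant _ _ e _ | inner _ _ _ _ = inj₁ (pendant⊏inner ρ e σ v∈X)
      ... | _ | _ | pendant _ _ e _ | pendant _ _ e′ _ = contradiction (E-unique e e′) u≢v
      ... | _ | _ | inner _ _ _ _ | inner _ _ _ _ =
        [ inj₁ ∘ inner⊏inner ρ σ , inj₂ ∘ inner⊏inner σ ρ ]′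
          (chain (cong inner? ρ) (cong inner? σ) u≢v)

module Without {n} {X : Fin n → Bool} {b : Fin n} (b∈X : X b ≡ true) where
  open Extend X b b∈X (λ _ → false) (λ ()) public

  size-without : size X ≡ suc (size X°)
  size-without = trans size-split (cong (λ e → suc (e + size X°)) (sum-zero {n} λ _ → refl))

  without⊆ : ∀ {u} → X° u ≡ true → X u ≡ true × b ≢ u
  without⊆ {u} u∈X° with role u | roleView u
  ... | .inner | inner b≢u _ _ u∈X = u∈X , b≢u

  without⁺ : ∀ {u} → X u ≡ true → b ≢ u → X° u ≡ true
  without⁺ {u} u∈X b≢u with role u | roleView u
  ... | .top     | top b≡u _ _ _     = contradiction b≡u b≢u
  ... | .inner   | inner _ _ _ _     = refl
  ... | .outside | outside _ _ _ u∉X = contradiction (trans (sym u∈X) u∉X) λ ()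

module Ends {n} {X : Fin n → Bool} {a b : Fin n}
  (a∈X : X a ≡ true) (b∈X : X b ≡ true) (b≢a : b ≢ a) where

  E : Fin n → Bool
  E u = does (a ≟ u)

  E⇒≡ : ∀ {u} → E u ≡ true → a ≡ u
  E⇒≡ {u} u∈E with a ≟ u
  ... | yes a≡u = a≡u

  E⊆X : ∀ {u} → E u ≡ true → X u ≡ true × b ≢ u
  E⊆X u∈E with E⇒≡ u∈E
  ... | refl = a∈X , b≢a

  open Extend X b b∈X E E⊆X public

  size-ends : size X ≡ suc (suc (size X°))
  size-ends = trans size-split (cong (λ e → suc (e + size X°)) (sum-δ a))

-- Chains on cliques of odd size.

empty : ∀ {n} {X : Fin n → Bool} → Weighting X
empty = record
  { w      = λ _ _ → 0
  ; w-sym  = λ _ _ → refl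
  ; w≤2    = λ _ _ → z≤n
  ; w-diag = λ _ → refl
  ; w-supp = λ _ _ → refl
  }

-- Here `j` counts the peeling rounds, so `X` is meant to have `2 * j + 1` vertices. Each round
-- gives `m` two red copies towards the upper end and none towards the lower one, whence `s-m`. The
-- bound `4 * j` is the full degree in the doubled clique.
record OddChain {n} (X : Fin n → Bool) (h : Fin n → ℕ) (j : ℕ) : Set where
  field
    weighting : Weighting X
  open Weighting weighting public
  field
    m      : Fin n
    m∈X    : X m ≡ true
    chain  : IsChain h weighting m
    s-m    : s m ≡ 2 * j
    s-odd  : ∀ {v} → X v ≡ true → v ≢ m → ∃[ q ] s v ≡ suc (2 * q)
    s-≤    : ∀ {v} → X v ≡ true → s v ≤ 4 * j

  -- The bound `4 * j` is even, while `m`, the only vertex of even red degree, has `2 * j`, which is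
  -- smaller for positive `j`.
  s-< : ∀ {v} → 0 < j → X v ≡ true → s v < 4 * j
  s-< {v} 0<j v∈X = ≤∧≢⇒< (s-≤ v∈X) s≢
    where
    4j≡ : 4 * j ≡ 2 * (2 * j)
    4j≡ = *-assoc 2 2 j

    s≢ : s v ≢ 4 * j
    s≢ s≡ with v ≟ m
    ... | yes refl = <⇒≢ (*-monoˡ-< j {{>-nonZero 0<j}} (s≤s (s≤s (s≤s (z≤n {1}))))) (trans (sym s-m) s≡)
    ... | no v≢m   = let q , s≡1+2q = s-odd v∈X v≢m in
                     even≢odd (2 * j) q (trans (sym 4j≡) (trans (sym s≡) s≡1+2q))

-- One peeling round read backwards. The vertex `b` gets red degree `4 * j + 3`, just above the
-- largest possible inner degree `4 * j + 2`, and `a` gets 1. Both are odd, and inner parities do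
-- not change, so `m` remains the only even vertex.
addEnds : ∀ {n} {X : Fin n → Bool} {h : Fin n → ℕ} {a b} j
  (a∈X : X a ≡ true) (b∈X : X b ≡ true) (b≢a : b ≢ a) →
  (∀ u → X u ≡ true → h u ≤ h b) → (∀ v → X v ≡ true → h a ≤ h v) →
  size X ≡ suc (2 * suc j) → OddChain (Ends.X° {X = X} a∈X b∈X b≢a) h j → OddChain X h (suc j)
addEnds {X = X} {h} {a} {b} j a∈X b∈X b≢a h≤b a≤h |X|≡3+2j O = record
  { weighting = extended weighting
  ; m      = m
  ; m∈X    = X°⊆X m∈X
  ; chain  = extended-chain weighting h m (inner⁻ m∈X) h≤b pendant≤h
               (λ u∈E v∈E → trans (sym (E⇒≡ u∈E)) (E⇒≡ v∈E)) s<top chain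
  ; s-m    = trans (s-inner weighting (inner⁻ m∈X)) (trans (cong (_+ 2) s-m) (2i+2≡2[1+i] j))
  ; s-odd  = s-odd′
  ; s-≤    = s-≤′
  }
  where
  open Ends {X = X} a∈X b∈X b≢a
  open OddChain O

  |X°| : size X° ≡ suc (2 * j)
  |X°| = suc-injective (suc-injective (trans (sym size-ends) (trans |X|≡3+2j (cong suc (*-suc 2 j)))))

  open Weighting (extended weighting) using () renaming (s to s′)

  pendant≤h : ∀ {u} → E u ≡ true → ∀ v → X v ≡ true → h u ≤ h v
  pendant≤h u∈E with E⇒≡ u∈E
  ... | refl = a≤h

  s-b : s′ b ≡ suc (2 * suc (2 * j))
  s-b = trans (s-top weighting) (trans (cong₂ (λ i e → 2 * i + 1 * e) |X°| (sum-δ a)) (+-comm _ 1))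

  s<top : ∀ {u} → role u ≡ inner → s u + 2 < s′ b
  s<top {u} u-inner = subst (s u + 2 <_) (sym s-b) (s≤s (begin
    s u + 2         ≤⟨ +-monoˡ-≤ 2 (s-≤ (cong inner? u-inner)) ⟩
    4 * j + 2       ≡⟨ 4i+2≡2[1+2i] j ⟩
    2 * suc (2 * j) ∎))
    where open ≤-Reasoning

  s-odd′ : ∀ {v} → X v ≡ true → v ≢ m → ∃[ q ] s′ v ≡ suc (2 * q)
  s-odd′ {v} v∈X v≢m with member-role v∈X
  ... | inj₁ refl             = suc (2 * j) , s-b
  ... | inj₂ (inj₁ v-inner)   =
    let q , s≡ = s-odd (cong inner? v-inner) v≢m
    in suc q , trans (s-inner weighting v-inner) (trans (cong (_+ 2) s≡) (cong suc (2i+2≡2[1+i] q)))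
  ... | inj₂ (inj₂ v-pendant) = 0 , s-pendant weighting v-pendant

  s-b≤ : s′ b ≤ 4 * suc j
  s-b≤ = begin
    s′ b                        ≡⟨ s-b ⟩
    suc (2 * suc (2 * j))       ≤⟨ n≤1+n _ ⟩
    suc (suc (2 * suc (2 * j))) ≡⟨ rearrange j ⟩
    4 * suc j                   ∎
    where
    open ≤-Reasoning
    rearrange : ∀ i → suc (suc (2 * suc (2 * i))) ≡ 4 * suc i
    rearrange = solve-∀

  s-≤′ : ∀ {v} → X v ≡ true → s′ v ≤ 4 * suc j
  s-≤′ {v} v∈X with member-role v∈X
  ... | inj₁ refl             = s-b≤
  ... | inj₂ (inj₁ v-inner)   =
    ≤-trans (≤-reflexive (s-inner weighting v-inner)) (≤-trans (<⇒≤ (s<top v-inner)) s-b≤)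
  ... | inj₂ (inj₂ v-pendant) = ≤-trans (≤-reflexive (s-pendant weighting v-pendant)) (s≤s z≤n)

oddChain : ∀ {n} (h : Fin n → ℕ) j (X : Fin n → Bool) → size X ≡ suc (2 * j) → OddChain X h j
oddChain {n} h zero X |X|≡1 = record
  { weighting = empty
  ; m      = m
  ; m∈X    = m∈X
  ; chain  = λ u∈X v∈X u≢v → contradiction (singleton-unique {X = X} |X|≡1 u∈X v∈X) u≢v
  ; s-m    = sum-zero {n} λ _ → refl
  ; s-odd  = λ v∈X v≢m → contradiction (singleton-unique {X = X} |X|≡1 v∈X m∈X) v≢m
  ; s-≤    = λ _ → ≤-reflexive (sum-zero {n} λ _ → refl)
  }
  where
  m   = proj₁ (member {X = X} |X|≡1)
  m∈X = proj₂ (member {X = X} |X|≡1)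
oddChain {n} h (suc j) X |X|≡3+2j with greatest h {X} |X|≡3+2j
-- Choosing `a` among the vertices other than `b` ensures that the two differ even when `h` is
-- constant on `X`.
... | b , b∈X , h≤b with least h {Without.X° {X = X} b∈X} {suc (2 * j)}
                           (suc-injective (trans (sym (Without.size-without {X = X} b∈X))
                             (trans |X|≡3+2j (cong suc (*-suc 2 j)))))
... | a , a∈X∖b , a≤h = addEnds j a∈X b∈X b≢a h≤b a≤ |X|≡3+2j (oddChain h j X° |X°|)
  where
  a∈X : X a ≡ true
  a∈X = proj₁ (Without.without⊆ {X = X} b∈X a∈X∖b)

  b≢a : b ≢ a
  b≢a = proj₂ (Without.without⊆ {X = X} b∈X a∈X∖b)

  open Ends {X = X} a∈X b∈X b≢a using (X°; size-ends)

  |X°| : size X° ≡ suc (2 * j)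
  |X°| = suc-injective (suc-injective (trans (sym size-ends) (trans |X|≡3+2j (cong suc (*-suc 2 j)))))

  a≤ : ∀ v → X v ≡ true → h a ≤ h v
  a≤ v v∈X with b ≟ v
  -- The choice of `a` says nothing about `b` itself, where the maximality of `h b` is used instead.
  ... | yes refl = h≤b a a∈X
  ... | no b≢v   = a≤h v (Without.without⁺ {X = X} b∈X v∈X b≢v)

-- Seeds for cliques with at least two vertices.

-- What the clique weighting has to satisfy when the edges leaving X are red except at m, where they
-- are blue.  With |X| = K + 1, blue degrees are 2K - s u for u ≠ m and 2K + 2 h m - s m for m.
record Seed {n} (X : Fin n → Bool) (h : Fin n → ℕ) (K : ℕ) : Set where
  field
    weighting : Weighting X
  open Weighting weighting public
  field
    m        : Fin n
    m∈X      : X m ≡ true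
    red      : ∀ {u v} → X u ≡ true → X v ≡ true → u ≢ m → v ≢ m → u ≢ v →
               0 < w u v → s u + 2 * h u ≢ s v + 2 * h v
    blue     : ∀ {u v} → X u ≡ true → X v ≡ true → u ≢ m → v ≢ m → u ≢ v →
               w u v < 2 → s u ≢ s v
    red-m    : ∀ {v} → X v ≡ true → v ≢ m → 0 < w m v → s m ≢ s v + 2 * h v
    blue-m   : ∀ {v} → X v ≡ true → v ≢ m → w m v < 2 → s m ≢ s v + 2 * h m
    s-parity : ∀ {v} → X v ≡ true → v ≢ m → (∃[ q ] s v ≡ suc (2 * q)) ⊎ s v ≡ 2 * K
    s-m<     : s m < 2 * K

module _ {n} {X : Fin n → Bool} {h : Fin n → ℕ} {K : ℕ} (W : Weighting X) where
  open Weighting W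

  -- Along the chain `s` grows strictly and `h` weakly, so both `s` and `s + 2 * h` separate the
  -- vertices other than `m`. In red, a vertex above `m` already has larger `s`, and a vertex below
  -- `m` shares no red edge with it.
  chain⇒seed : ∀ {m} → X m ≡ true → IsChain h W m → (∃[ p ] s m ≡ 2 * p) →
    (∀ {v} → X v ≡ true → v ≢ m → (∃[ q ] s v ≡ suc (2 * q)) ⊎ s v ≡ 2 * K) →
    s m < 2 * K → Seed X h K
  chain⇒seed {m} m∈X chain (p , s-m≡2p) s-parity s-m< = record
    { weighting = W
    ; m        = m
    ; m∈X      = m∈X
    ; red      = λ u∈X v∈X _ _ u≢v _ →
        [ <⇒≢ ∘ r< , ≢-sym ∘ <⇒≢ ∘ r< ]′ (chain u∈X v∈X u≢v)
    ; blue     = λ u∈X v∈X _ _ u≢v _ →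
        [ <⇒≢ ∘ s< , ≢-sym ∘ <⇒≢ ∘ s< ]′ (chain u∈X v∈X u≢v)
    ; red-m    = λ {v} v∈X v≢m w>0 → [ (λ m⊏v → <⇒≢ (<-≤-trans (s< m⊏v) (m≤m+n _ _)))
        , (λ v⊏m → contradiction (trans (w-sym m v) (to-m v⊏m refl)) (≢-sym (<⇒≢ w>0)))
        ]′ (chain m∈X v∈X (≢-sym v≢m))
    ; blue-m   = λ v∈X v≢m _ → blue-m v∈X v≢m
    ; s-parity = s-parity
    ; s-m<     = s-m<
    }
    where
    open _⊏_
    r< : ∀ {u v} → _⊏_ h W m u v → s u + 2 * h u < s v + 2 * h v
    r< u⊏v = +-mono-<-≤ (s< u⊏v) (*-monoʳ-≤ 2 (h≤ u⊏v))

    -- If `s v` is odd, the two sides differ in parity. If `s v` is `2 * K`, the right side is at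
    -- least `2 * K`, which exceeds `s m`.
    blue-m : ∀ {v} → X v ≡ true → v ≢ m → s m ≢ s v + 2 * h m
    blue-m {v} v∈X v≢m s-m≡ with s-parity v∈X v≢m
    ... | inj₁ (q , s≡) = even≢odd p (q + h m) (begin
      2 * p                     ≡⟨ s-m≡2p ⟨
      s m                       ≡⟨ s-m≡ ⟩
      s v + 2 * h m             ≡⟨ cong (_+ 2 * h m) s≡ ⟩
      suc (2 * q + 2 * h m)     ≡⟨ cong suc (*-distribˡ-+ 2 q (h m)) ⟨
      suc (2 * (q + h m))       ∎)
      where open ≡-Reasoning
    ... | inj₂ s≡ = <⇒≢ (<-≤-trans s-m< (subst (λ t → t ≤ s v + 2 * h m) s≡ (m≤m+n (s v) (2 * h m)))) s-m≡

oddSeed : ∀ {n} {X : Fin n → Bool} (h : Fin n → ℕ) j → size X ≡ suc (2 * suc j) → Seed X h (2 * suc j)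
oddSeed {X = X} h j |X|≡ = chain⇒seed weighting m∈X chain (suc j , s-m)
  -- With `K` equal to `2 * suc j`, the last condition reads `2 * suc j < 2 * K`, which holds
  -- because at least one round has been made.
  (λ v∈X v≢m → inj₁ (s-odd v∈X v≢m)) (subst (_< 2 * (2 * suc j)) (sym s-m) (m<m+n _ (s≤s z≤n)))
  where open OddChain (oddChain h (suc j) X |X|≡)

-- The added vertex is joined to the rest in red only, so its red degree is `2 * K`: this is what
-- the second alternative of `s-parity` is for.
addTop : ∀ {n} {X : Fin n → Bool} {h : Fin n → ℕ} {b} j (b∈X : X b ≡ true) →
  (∀ u → X u ≡ true → h u ≤ h b) → size X ≡ suc (suc (2 * suc j)) →
  OddChain (Without.X° {X = X} b∈X) h (suc j) → Seed X h (suc (2 * suc j))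
addTop {n} {X}  {h} {b} j b∈X h≤b |X|≡ O = chain⇒seed (extended weighting) {m} (X°⊆X m∈X) chain′
  (suc (suc j) , trans s′-m (2i+2≡2[1+i] (suc j))) s-parity s′-m<
  where
  open Without {X = X} b∈X
  open OddChain O

  |X°| : size X° ≡ suc (2 * suc j)
  |X°| = suc-injective (trans (sym size-without) |X|≡)

  open Weighting (extended weighting) using () renaming (s to s′)

  m-inner : role m ≡ inner
  m-inner = inner⁻ m∈X

  s′-m : s′ m ≡ 2 * suc j + 2
  s′-m = trans (s-inner weighting m-inner) (cong (_+ 2) s-m)

  s-b : s′ b ≡ 2 * suc (2 * suc j)
  s-b = trans (s-top weighting)
    (trans (cong₂ (λ i e → 2 * i + 1 * e) |X°| (sum-zero {n} {f = λ _ → 0} λ _ → refl)) (+-identityʳ _))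

  s<top : ∀ {u} → role u ≡ inner → s u + 2 < s′ b
  s<top {u} u-inner = begin-strict
    -- The red degree of `b` is exactly `4 * suc j + 2`, so `s-≤` does not suffice and the strict
    -- `s-<` is needed.
    s u + 2               <⟨ +-monoˡ-< 2 (s-< (s≤s z≤n) (cong inner? u-inner)) ⟩
    4 * suc j + 2         ≡⟨ 4i+2≡2[1+2i] (suc j) ⟩
    2 * suc (2 * suc j)   ≡⟨ s-b ⟨
    s′ b                  ∎
    where open ≤-Reasoning

  chain′ : IsChain h (extended weighting) m
  chain′ = extended-chain weighting h m m-inner h≤b (λ ()) (λ ()) s<top chain

  s′-m< : s′ m < 2 * suc (2 * suc j)
  s′-m< = begin-strict
    s′ m                ≡⟨ s-inner weighting m-inner ⟩
    s m + 2             <⟨ s<top m-inner ⟩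
    s′ b                ≡⟨ s-b ⟩
    2 * suc (2 * suc j) ∎
    where open ≤-Reasoning

  s-parity : ∀ {v} → X v ≡ true → v ≢ m → (∃[ q ] s′ v ≡ suc (2 * q)) ⊎ s′ v ≡ 2 * suc (2 * suc j)
  s-parity v∈X v≢m with member-role v∈X
  ... | inj₁ refl           = inj₂ s-b
  ... | inj₂ (inj₁ v-inner) =
    let q , s≡ = s-odd (cong inner? v-inner) v≢m
    in inj₁ (suc q , trans (s-inner weighting v-inner) (trans (cong (_+ 2) s≡) (cong suc (2i+2≡2[1+i] q))))
  ... | inj₂ (inj₂ v-pendant) = case pendant⁻ v-pendant of λ ()

evenSeed : ∀ {n} {X : Fin n → Bool} (h : Fin n → ℕ) j → size X ≡ suc (suc (2 * suc j)) →
  Seed X h (suc (2 * suc j))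
evenSeed {X = X} h j |X|≡ with greatest h {X} |X|≡
... | b , b∈X , h≤b = addTop j b∈X h≤b |X|≡
  (oddChain h (suc j) X° (suc-injective (trans (sym size-without) |X|≡)))
  where open Without {X = X} b∈X

-- Both vertices have red degree 1 within `X`, so only the edges leaving `X` can tell them apart.
-- Those at `b` are red and those at `m`, which is `a`, are blue; as there are some at both
-- vertices, the degrees differ in each colour.
pairSeed : ∀ {n} {X : Fin n → Bool} (h : Fin n → ℕ) → size X ≡ 2 →
  (∀ {u} → X u ≡ true → 0 < h u) → Seed X h 1
pairSeed {n} {X} h |X|≡2 h>0 with member {X = X} |X|≡2
... | b , b∈X with member {X = Without.X° {X = X} b∈X}
                     (suc-injective (trans (sym (Without.size-without {X = X} b∈X)) |X|≡2))
... | a , a∈X∖b = record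
  { weighting = extended empty
  ; m        = a
  ; m∈X      = a∈X
  ; red      = λ u∈X v∈X u≢a v≢a u≢v _ → contradiction (trans (sym (≡b u∈X u≢a)) (≡b v∈X v≢a)) u≢v
  ; blue     = λ u∈X v∈X u≢a v≢a u≢v _ → contradiction (trans (sym (≡b u∈X u≢a)) (≡b v∈X v≢a)) u≢v
  ; red-m    = λ {v} v∈X v≢a _ → 1≢1+2h s-a (s≡1 v∈X v≢a) (h>0 v∈X)
  ; blue-m   = λ {v} v∈X v≢a _ → 1≢1+2h s-a (s≡1 v∈X v≢a) (h>0 a∈X)
  ; s-parity = λ v∈X v≢a → inj₁ (0 , s≡1 v∈X v≢a)
  ; s-m<     = ≤-reflexive (cong suc s-a)
  }
  where
  a∈X : X a ≡ true
  a∈X = proj₁ (Without.without⊆ {X = X} b∈X a∈X∖b)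

  b≢a : b ≢ a
  b≢a = proj₂ (Without.without⊆ {X = X} b∈X a∈X∖b)

  open Ends {X = X} a∈X b∈X b≢a

  |X°| : size X° ≡ 0
  |X°| = suc-injective (suc-injective (trans (sym size-ends) |X|≡2))

  no-inner : ∀ {u} → role u ≢ inner
  no-inner {u} u-inner = contradiction
    (subst₂ _≤_ (cong (⟦_⟧ ∘ inner?) u-inner) |X°| (term≤sum (λ v → ⟦ X° v ⟧) u)) λ ()

  open Weighting (extended empty)

  ≡b : ∀ {u} → X u ≡ true → u ≢ a → b ≡ u
  ≡b {u} u∈X u≢a with member-role u∈X
  ... | inj₁ b≡u              = b≡u
  ... | inj₂ (inj₁ u-inner)   = contradiction u-inner no-inner
  ... | inj₂ (inj₂ u-pendant) = contradiction (sym (E⇒≡ (pendant⁻ u-pendant))) u≢a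

  s-a : s a ≡ 1
  s-a with member-role a∈X
  ... | inj₁ b≡a              = contradiction b≡a b≢a
  ... | inj₂ (inj₁ a-inner)   = contradiction a-inner no-inner
  ... | inj₂ (inj₂ a-pendant) = s-pendant empty a-pendant

  s≡1 : ∀ {v} → X v ≡ true → v ≢ a → s v ≡ 1
  s≡1 v∈X v≢a with ≡b v∈X v≢a
  ... | refl = trans (s-top empty) (cong₂ (λ i e → 2 * i + 1 * e) |X°| (sum-δ a))

  1≢1+2h : ∀ {s₁ s₂ h} → s₁ ≡ 1 → s₂ ≡ 1 → 0 < h → s₁ ≢ s₂ + 2 * h
  1≢1+2h refl refl (s≤s _) ()

-- From red and blue multiplicities to an edge colouring.

-- Colour 0F goes to the first r parallel edges and 1F to the others.
firsts : ℕ → ∀ {m} → Fin m → Fin 2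
firsts zero    _       = suc zero
firsts (suc r) zero    = zero
firsts (suc r) (suc i) = firsts r i

firsts-cast : ∀ r {m m′} (m≡m′ : m ≡ m′) i → firsts r (cast m≡m′ i) ≡ firsts r i
firsts-cast r refl i = cong (firsts r) (cast-is-id refl i)

count-0 : ∀ r b → count (_≟ zero) (tabulate {n = r + b} (firsts r)) ≡ r
count-0 zero    zero    = refl
count-0 zero    (suc b) = count-0 zero b
count-0 (suc r) b       = cong suc (count-0 r b)

count-1 : ∀ r b → count (_≟ suc zero) (tabulate {n = r + b} (firsts r)) ≡ b
count-1 zero    zero    = refl
count-1 zero    (suc b) = cong suc (count-1 zero b)
count-1 (suc r) b       = count-1 r b

module _ {n} (M : Multigraph n) where
  open Multigraph M

  -- Only the number of copies of each colour matters for degrees, so `firsts` realises any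
  -- splitting of `mult` into `R` and `B`. The symmetry of `R` makes the two views of an edge agree.
  lir≤2 : (R B : Fin n → Fin n → ℕ) → (∀ u v → R u v ≡ R v u) → (∀ u v → R u v + B u v ≡ mult u v) →
    (∀ u v → 0 < R u v → sum (R u) ≢ sum (R v)) →
    (∀ u v → 0 < B u v → sum (B u) ≢ sum (B v)) →
    lir M ≤ 2
  lir≤2 R B R-sym R+B≡mult R-irregular B-irregular = c , irregular
    where
    c : EdgeColouring M 2
    c = record
      { colour     = λ u v → firsts (R u v)
      ; colour-sym = λ u v i →
          trans (firsts-cast (R v u) (mult-sym u v) i) (cong (λ r → firsts r i) (R-sym v u))
      }
    open EdgeColouring c using (colourClass)

    class : Fin 2 → Fin n → Fin n → ℕ
    class zero    = R
    class (suc _) = B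

    class-irregular : ∀ a u v → 0 < class a u v → sum (class a u) ≢ sum (class a v)
    class-irregular zero       = R-irregular
    class-irregular (suc zero) = B-irregular

    mult≡class : ∀ a u v → Multigraph.mult (colourClass a) u v ≡ class a u v
    mult≡class zero u v with mult u v | R+B≡mult u v
    ... | _ | refl = count-0 (R u v) (B u v)
    mult≡class (suc zero) u v with mult u v | R+B≡mult u v
    ... | _ | refl = count-1 (R u v) (B u v)

    irregular : EdgeColouring.IsLocallyIrregular c
    irregular a u v adj deg≡ = class-irregular a u v (subst (0 <_) (mult≡class a u v) adj)
      (trans (sym (sum-cong-≗ (mult≡class a u))) (trans deg≡ (sum-cong-≗ (mult≡class a v))))

-- Colouring the doubled split graph from a seed.

module _ {n} (G : SimpleGraph n) where
  open SimpleGraph G hiding (IsSplit; Connected)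

  A : Fin n → Fin n → ℕ
  A u v = ⟦ does (u ~? v) ⟧

  A-yes : ∀ {u v} → u ~ v → A u v ≡ 1
  A-yes {u} {v} u~v = cong ⟦_⟧ (dec-true (u ~? v) u~v)

  A-no : ∀ {u v} → ¬ u ~ v → A u v ≡ 0
  A-no {u} {v} u≁v = cong ⟦_⟧ (dec-false (u ~? v) u≁v)

  A>0⇒~ : ∀ {u v} → 0 < A u v → u ~ v
  A>0⇒~ {u} {v} A>0 with u ~? v
  ... | yes u~v = u~v

  A≤1 : ∀ u v → A u v ≤ 1
  A≤1 u v with u ~? v
  ... | yes _ = ≤-refl
  ... | no _  = z≤n

  A-sym : ∀ u v → A u v ≡ A v u
  A-sym u v with u ~? v
  ... | yes u~v = sym (A-yes (~-sym u~v))
  ... | no u≁v  = sym (A-no (u≁v ∘ ~-sym))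

  2A≡mult : ∀ u v → 2 * A u v ≡ Multigraph.mult (² G) u v
  2A≡mult u v with does (u ~? v)
  ... | true  = refl
  ... | false = refl

  module FromSeed (X : Fin n → Bool)
    (clique : ∀ {u v} → X u ≡ true → X v ≡ true → u ≢ v → u ~ v)
    (independent : ∀ {u v} → X u ≡ false → X v ≡ false → ¬ u ~ v)
    {K : ℕ} (|X|≡1+K : size X ≡ suc K)
    (seed : Seed X (λ u → sum (λ v → A u v * ⟦ not (X v) ⟧)) K) where
    open Seed seed

    -- `g` and `f` indicate the complement of `X` and the set `X` without `m`; `h` and `e` count the
    -- neighbours in these two sets, and `d` is the degree in `G`. Leaving `m` out of `f` reflects
    -- that its edges out of `X` are blue.
    g f h e d : Fin n → ℕ
    g v = ⟦ not (X v) ⟧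
    f v = if does (m ≟ v) then 0 else ⟦ X v ⟧
    h u = sum (λ v → A u v * g v)
    e u = sum (λ v → A u v * f v)
    d u = sum (A u)

    data Part (u : Fin n) : Set where
      is-m : m ≡ u → X u ≡ true → f u ≡ 0 → g u ≡ 0 → Part u
      in-X : m ≢ u → X u ≡ true → f u ≡ 1 → g u ≡ 0 → Part u
      in-Y : m ≢ u → X u ≡ false → f u ≡ 0 → g u ≡ 1 → Part u

    f≡ : ∀ {u t x} → (m ≟ u) ≡ t → X u ≡ x → f u ≡ (if does t then 0 else ⟦ x ⟧)
    f≡ = cong₂ λ t x → if does t then 0 else ⟦ x ⟧

    g≡ : ∀ {u x} → X u ≡ x → g u ≡ ⟦ not x ⟧
    g≡ = cong (⟦_⟧ ∘ not)

    part : ∀ u → Part u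
    part u with m ≟ u in eq | X u in u∈X
    ... | yes refl | true  = is-m refl u∈X (f≡ eq u∈X) (g≡ u∈X)
    ... | yes refl | false = contradiction (trans (sym m∈X) u∈X) λ ()
    ... | no m≢u   | true  = in-X m≢u u∈X (f≡ eq u∈X) (g≡ u∈X)
    ... | no m≢u   | false = in-Y m≢u u∈X (f≡ eq u∈X) (g≡ u∈X)

    -- The bracket `f u * g v + g u * f v` is 1 exactly when one end lies in `X` without `m` and the
    -- other outside `X`; such edges become entirely red. The product form lets the factors at `u`
    -- be taken out of the degree sum in `r-formula`.
    R B : Fin n → Fin n → ℕ
    R u v = w u v + 2 * (A u v * (f u * g v + g u * f v))
    B u v = 2 * A u v ∸ R u v

    R-sym : ∀ u v → R u v ≡ R v u
    R-sym u v = cong₂ (λ x y → x + 2 * y) (w-sym u v)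
      (cong₂ _*_ (A-sym u v) (trans (+-comm (f u * g v) _)
        (cong₂ _+_ (*-comm (g u) (f v)) (*-comm (f u) (g v)))))

    R-clique : ∀ {u v} → g u ≡ 0 → g v ≡ 0 → R u v ≡ w u v
    R-clique {u} {v} gu gv rewrite gu | gv | *-zeroʳ (f u) | *-zeroʳ (A u v) = +-identityʳ _

    R-zero : ∀ {u v} → X u ≡ false → f u ≡ 0 → f v ≡ 0 → R u v ≡ 0
    R-zero {u} {v} u∉X fu fv rewrite w-supp v u∉X | fu | fv | *-zeroʳ (g u) | *-zeroʳ (A u v) = refl

    R-cross : ∀ {u v} → X u ≡ false → f u ≡ 0 → g u ≡ 1 → f v ≡ 1 → R u v ≡ 2 * A u v
    R-cross {u} {v} u∉X fu gu fv rewrite w-supp v u∉X | fu | gu | fv = cong (2 *_) (*-identityʳ (A u v))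

    2A≤2 : ∀ u v → 2 * A u v ≤ 2
    2A≤2 u v = *-monoʳ-≤ 2 (A≤1 u v)

    R-clique≤ : ∀ {u v} → X u ≡ true → X v ≡ true → g u ≡ 0 → g v ≡ 0 → R u v ≤ 2 * A u v
    R-clique≤ {u} {v} u∈X v∈X gu gv with u ≟ v
    ... | yes refl = ≤-trans (≤-reflexive (trans (R-clique gu gv) (w-diag u))) z≤n
    ... | no u≢v   = subst₂ _≤_ (sym (R-clique gu gv))
      (sym (cong (2 *_) (A-yes (clique u∈X v∈X u≢v)))) (w≤2 u v)

    -- This makes the truncated subtraction in `B` exact. Within the clique it rests on `w≤2`, and
    -- an edge between `X` and its complement has either all or none of its copies red.
    R≤2A : ∀ u v → R u v ≤ 2 * A u v
    R≤2A u v with part u | part v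
    ... | is-m _ u∈X _ gu  | is-m _ v∈X _ gv  = R-clique≤ u∈X v∈X gu gv
    ... | is-m _ u∈X _ gu  | in-X _ v∈X _ gv  = R-clique≤ u∈X v∈X gu gv
    ... | in-X _ u∈X _ gu  | is-m _ v∈X _ gv  = R-clique≤ u∈X v∈X gu gv
    ... | in-X _ u∈X _ gu  | in-X _ v∈X _ gv  = R-clique≤ u∈X v∈X gu gv
    ... | in-Y _ u∉X fu _  | is-m _ _ fv _    = ≤-trans (≤-reflexive (R-zero u∉X fu fv)) z≤n
    ... | in-Y _ u∉X fu _  | in-Y _ _ fv _    = ≤-trans (≤-reflexive (R-zero u∉X fu fv)) z≤n
    ... | is-m _ _ fu _    | in-Y _ v∉X fv _  =
      ≤-trans (≤-reflexive (trans (R-sym u v) (R-zero v∉X fv fu))) z≤n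
    ... | in-Y _ u∉X fu gu | in-X _ _ fv _    = ≤-reflexive (R-cross u∉X fu gu fv)
    ... | in-X _ _ fu _    | in-Y _ v∉X fv gv = ≤-reflexive (trans (R-sym u v)
      (trans (R-cross v∉X fv gv fu) (cong (2 *_) (A-sym v u))))

    R+B≡2A : ∀ u v → R u v + B u v ≡ 2 * A u v
    R+B≡2A u v = m+[n∸m]≡n (R≤2A u v)

    B-sym : ∀ u v → B u v ≡ B v u
    B-sym u v = cong₂ (λ x y → 2 * x ∸ y) (A-sym u v) (R-sym u v)

    r b : Fin n → ℕ
    r u = sum (R u)
    b u = sum (B u)

    r+b≡2d : ∀ u → r u + b u ≡ 2 * d u
    r+b≡2d u = begin
      r u + b u                    ≡⟨ ∑-distrib-+ (R u) (B u) ⟨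
      sum (λ v → R u v + B u v)    ≡⟨ sum-cong-≗ (R+B≡2A u) ⟩
      sum (λ v → 2 * A u v)        ≡⟨ *-distribˡ-sum 2 (A u) ⟨
      2 * d u                      ∎
      where open ≡-Reasoning

    r-formula : ∀ u → r u ≡ s u + 2 * (f u * h u + g u * e u)
    r-formula u = begin
      r u
        ≡⟨ ∑-distrib-+ (w u) (λ v → 2 * (A u v * (f u * g v + g u * f v))) ⟩
      s u + sum (λ v → 2 * (A u v * (f u * g v + g u * f v)))
        ≡⟨ cong (s u +_) (*-distribˡ-sum 2 (λ v → A u v * (f u * g v + g u * f v))) ⟨
      s u + 2 * sum (λ v → A u v * (f u * g v + g u * f v))
        ≡⟨ cong (λ t → s u + 2 * t) (sum-cong-≗ λ v → rearrange (A u v) (f u) (g v) (g u) (f v)) ⟩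
      s u + 2 * sum (λ v → f u * (A u v * g v) + g u * (A u v * f v))
        ≡⟨ cong (λ t → s u + 2 * t) (sum-linear (f u) (g u) (λ v → A u v * g v) (λ v → A u v * f v)) ⟩
      s u + 2 * (f u * h u + g u * e u) ∎
      where
      open ≡-Reasoning
      rearrange : ∀ a x y z t → a * (x * y + z * t) ≡ x * (a * y) + z * (a * t)
      rearrange = solve-∀

    r-m : ∀ {u} → f u ≡ 0 → g u ≡ 0 → r u ≡ s u
    r-m {u} fu gu rewrite r-formula u | fu | gu = +-identityʳ _

    r-X : ∀ {u} → f u ≡ 1 → g u ≡ 0 → r u ≡ s u + 2 * h u
    r-X {u} fu gu rewrite r-formula u | fu | gu = cong (λ t → s u + 2 * t)
      (trans (+-identityʳ (h u + 0)) (+-identityʳ (h u)))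

    r-Y : ∀ {u} → X u ≡ false → f u ≡ 0 → g u ≡ 1 → r u ≡ 2 * e u
    r-Y {u} u∉X fu gu rewrite r-formula u | fu | gu | sum-zero {f = w u} (λ v → w-supp v u∉X) =
      cong (2 *_) (+-identityʳ (e u))

    |f|≡K : sum f ≡ K
    |f|≡K = suc-injective (begin
      suc (sum f)               ≡⟨ cong (_+ sum f) (sum-δ m) ⟨
      sum (δ m) + sum f         ≡⟨ ∑-distrib-+ (δ m) f ⟨
      sum (λ v → δ m v + f v)   ≡⟨ sum-cong-≗ pointwise ⟩
      size X                    ≡⟨ |X|≡1+K ⟩
      suc K                     ∎)
      where
      open ≡-Reasoning
      pointwise : ∀ v → δ m v + f v ≡ ⟦ X v ⟧
      pointwise v with m ≟ v
      ... | yes refl = cong ⟦_⟧ (sym m∈X)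
      ... | no _     = refl

    e≤K : ∀ u → e u ≤ K
    e≤K u = subst (e u ≤_) |f|≡K (sum-≤ λ v →
      ≤-trans (*-monoˡ-≤ (f v) (A≤1 u v)) (≤-reflexive (*-identityˡ (f v))))

    -- Adding `δ u` fills the gap that the missing loop leaves in row `u` of `A`, so that on `X` the
    -- row becomes constantly 1.
    d-X : ∀ {u} → X u ≡ true → d u ≡ K + h u
    d-X {u} u∈X = suc-injective (begin
      suc (d u)                              ≡⟨ cong (_+ d u) (sum-δ u) ⟨
      sum (δ u) + d u                        ≡⟨ ∑-distrib-+ (δ u) (A u) ⟨
      sum (λ v → δ u v + A u v)              ≡⟨ sum-cong-≗ pointwise ⟩
      sum (λ v → ⟦ X v ⟧ + A u v * g v)      ≡⟨ ∑-distrib-+ (λ v → ⟦ X v ⟧) (λ v → A u v * g v) ⟩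
      size X + h u                           ≡⟨ cong (_+ h u) |X|≡1+K ⟩
      suc (K + h u)                          ∎)
      where
      open ≡-Reasoning
      pointwise : ∀ v → δ u v + A u v ≡ ⟦ X v ⟧ + A u v * g v
      pointwise v with u ≟ v
      pointwise v | yes refl rewrite u∈X | A-no (~-irrefl u) = refl
      pointwise v | no u≢v with X v in v∈X
      ... | true  rewrite A-yes (clique u∈X v∈X u≢v) = refl
      ... | false = sym (*-identityʳ _)

    -- By independence all neighbours of `u` lie in `X`; `e u` counts those other than `m`.
    d-Y : ∀ {u} → X u ≡ false → d u ≡ e u + A u m
    d-Y {u} u∉X = begin
      d u                                          ≡⟨ sum-cong-≗ pointwise ⟩
      sum (λ v → A u v * f v + A u m * δ m v)      ≡⟨ ∑-distrib-+ (λ v → A u v * f v) (λ v → A u m * δ m v) ⟩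
      e u + sum (λ v → A u m * δ m v)              ≡⟨ cong (e u +_) (*-distribˡ-sum (A u m) (δ m)) ⟨
      e u + A u m * sum (δ m)                      ≡⟨ cong (λ t → e u + A u m * t) (sum-δ m) ⟩
      e u + A u m * 1                              ≡⟨ cong (e u +_) (*-identityʳ (A u m)) ⟩
      e u + A u m                                  ∎
      where
      open ≡-Reasoning
      pointwise : ∀ v → A u v ≡ A u v * f v + A u m * δ m v
      pointwise v with m ≟ v
      pointwise v | yes refl rewrite *-zeroʳ (A u m) | *-identityʳ (A u m) = refl
      pointwise v | no _ rewrite *-zeroʳ (A u m) with X v in v∈X
      ... | true  = sym (trans (+-identityʳ _) (*-identityʳ _))
      ... | false rewrite A-no (independent u∉X v∈X) = refl

    -- Blue degrees are obtained by taking the red ones from the doubled degree. Here and in `b-X`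
    -- this is kept in additive form to avoid truncated subtraction.
    b-m : s m + b m ≡ 2 * K + 2 * h m
    b-m with part m
    ... | is-m _ _ fm gm = begin
      s m + b m           ≡⟨ cong (_+ b m) (r-m fm gm) ⟨
      r m + b m           ≡⟨ r+b≡2d m ⟩
      2 * d m             ≡⟨ cong (2 *_) (d-X m∈X) ⟩
      2 * (K + h m)       ≡⟨ *-distribˡ-+ 2 K (h m) ⟩
      2 * K + 2 * h m     ∎
      where open ≡-Reasoning
    ... | in-X m≢m _ _ _ = contradiction refl m≢m
    ... | in-Y m≢m _ _ _ = contradiction refl m≢m

    b-X : ∀ {u} → X u ≡ true → f u ≡ 1 → g u ≡ 0 → s u + b u ≡ 2 * K
    b-X {u} u∈X fu gu = +-cancelʳ-≡ (2 * h u) _ _ (begin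
      s u + b u + 2 * h u     ≡⟨ x+y+z≡x+z+y (s u) (b u) (2 * h u) ⟩
      s u + 2 * h u + b u     ≡⟨ cong (_+ b u) (r-X fu gu) ⟨
      r u + b u               ≡⟨ r+b≡2d u ⟩
      2 * d u                 ≡⟨ cong (2 *_) (d-X u∈X) ⟩
      2 * (K + h u)           ≡⟨ *-distribˡ-+ 2 K (h u) ⟩
      2 * K + 2 * h u         ∎)
      where open ≡-Reasoning

    -- Red takes up `2 * e u` of the doubled degree, so only a possible edge to `m` is left for
    -- blue.
    b-Y : ∀ {u} → X u ≡ false → f u ≡ 0 → g u ≡ 1 → b u ≡ 2 * A u m
    b-Y {u} u∉X fu gu = +-cancelˡ-≡ (2 * e u) _ _ (begin
      2 * e u + b u           ≡⟨ cong (_+ b u) (r-Y u∉X fu gu) ⟨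
      r u + b u               ≡⟨ r+b≡2d u ⟩
      2 * d u                 ≡⟨ cong (2 *_) (d-Y u∉X) ⟩
      2 * (e u + A u m)       ≡⟨ *-distribˡ-+ 2 (e u) (A u m) ⟩
      2 * e u + 2 * A u m     ∎)
      where open ≡-Reasoning

    h>0 : ∀ {u v} → X v ≡ false → u ~ v → 0 < h u
    h>0 {u} {v} v∉X u~v = subst (_≤ h u) (cong₂ _*_ (A-yes u~v) (cong (⟦_⟧ ∘ not) v∉X))
      (term≤sum (λ v → A u v * g v) v)

    2A>0⇒~ : ∀ {u v} → 0 < 2 * A u v → u ~ v
    2A>0⇒~ {u} {v} 2A>0 = A>0⇒~ (*-cancelˡ-< 2 0 (A u v) 2A>0)

    R>0⇒~ : ∀ u v → 0 < R u v → u ~ v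
    R>0⇒~ u v R>0 = 2A>0⇒~ (≤-trans R>0 (R≤2A u v))

    B>0⇒~ : ∀ u v → 0 < B u v → u ~ v
    B>0⇒~ u v B>0 = 2A>0⇒~ (≤-trans B>0 (m∸n≤m (2 * A u v) (R u v)))

    ~⇒≢ : ∀ {u v} → u ~ v → u ≢ v
    ~⇒≢ {u} u~u refl = ~-irrefl u u~u

    -- The red degree of the outer vertex is even and, since `m` is not counted in `e`, at most
    -- `2 * K`. That of the clique vertex is odd, or else it is `2 * K + 2 * h u`, where `v` itself
    -- makes `h u` positive.
    red-cross : ∀ {u v} → m ≢ u → X u ≡ true → X v ≡ false → u ~ v → s u + 2 * h u ≢ 2 * e v
    red-cross {u} {v} m≢u u∈X v∉X u~v eq with s-parity u∈X (≢-sym m≢u)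
    ... | inj₁ (q , s≡) = even≢odd (e v) (q + h u) (begin
      2 * e v                 ≡⟨ eq ⟨
      s u + 2 * h u           ≡⟨ cong (_+ 2 * h u) s≡ ⟩
      suc (2 * q + 2 * h u)   ≡⟨ cong suc (*-distribˡ-+ 2 q (h u)) ⟨
      suc (2 * (q + h u))     ∎)
      where open ≡-Reasoning
    ... | inj₂ s≡ = <⇒≢ (begin-strict
      2 * e v            ≤⟨ *-monoʳ-≤ 2 (e≤K v) ⟩
      2 * K              <⟨ m<m+n (2 * K) (*-monoʳ-< 2 (h>0 v∉X u~v)) ⟩
      2 * K + 2 * h u    ≡⟨ cong (_+ 2 * h u) s≡ ⟨
      s u + 2 * h u      ∎) (sym eq)
      where open ≤-Reasoning

    R-irregular : ∀ u v → 0 < R u v → r u ≢ r v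
    R-irregular u v R>0 with part u | part v
    ... | is-m refl _ _ _      | is-m refl _ _ _     = contradiction (R>0⇒~ u v R>0) (~-irrefl u)
    ... | is-m refl _ fu gu    | in-X m≢v v∈X fv gv  = subst₂ _≢_ (sym (r-m fu gu)) (sym (r-X fv gv))
      (red-m v∈X (≢-sym m≢v) (subst (0 <_) (R-clique gu gv) R>0))
    ... | in-X m≢u u∈X fu gu   | is-m refl _ fv gv   = ≢-sym (subst₂ _≢_ (sym (r-m fv gv)) (sym (r-X fu gu))
      (red-m u∈X (≢-sym m≢u) (subst (0 <_) (trans (R-sym u v) (R-clique gv gu)) R>0)))
    ... | in-X m≢u u∈X fu gu   | in-X m≢v v∈X fv gv  = subst₂ _≢_ (sym (r-X fu gu)) (sym (r-X fv gv))
      (red u∈X v∈X (≢-sym m≢u) (≢-sym m≢v) (~⇒≢ (R>0⇒~ u v R>0)) (subst (0 <_) (R-clique gu gv) R>0))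
    ... | in-X m≢u u∈X fu gu   | in-Y _ v∉X fv gv    = subst₂ _≢_ (sym (r-X fu gu)) (sym (r-Y v∉X fv gv))
      (red-cross m≢u u∈X v∉X (R>0⇒~ u v R>0))
    ... | in-Y _ u∉X fu gu     | in-X m≢v v∈X fv gv  = ≢-sym (subst₂ _≢_ (sym (r-X fv gv)) (sym (r-Y u∉X fu gu))
      (red-cross m≢v v∈X u∉X (~-sym (R>0⇒~ u v R>0))))
    ... | in-Y _ u∉X fu _      | is-m _ _ fv _       = contradiction (R-zero u∉X fu fv) (≢-sym (<⇒≢ R>0))
    ... | in-Y _ u∉X fu _      | in-Y _ _ fv _       = contradiction (R-zero u∉X fu fv) (≢-sym (<⇒≢ R>0))
    ... | is-m _ _ fu _        | in-Y _ v∉X fv _     =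
      contradiction (trans (R-sym u v) (R-zero v∉X fv fu)) (≢-sym (<⇒≢ R>0))

    B>0⇒R<2 : ∀ u v → 0 < B u v → R u v < 2
    B>0⇒R<2 u v B>0 = begin-strict
      R u v           <⟨ m<m+n (R u v) B>0 ⟩
      R u v + B u v   ≡⟨ R+B≡2A u v ⟩
      2 * A u v       ≤⟨ 2A≤2 u v ⟩
      2               ∎
      where open ≤-Reasoning

    -- Cancelling a common blue degree from `b-m` and `b-X` would leave exactly the equation that
    -- `blue-m` forbids.
    blue-m-X : ∀ {v} → m ≢ v → X v ≡ true → f v ≡ 1 → g v ≡ 0 → w m v < 2 → b m ≢ b v
    blue-m-X {v} m≢v v∈X fv gv w<2 eq = blue-m v∈X (≢-sym m≢v) w<2 (+-cancelʳ-≡ (b m) _ _ (begin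
      s m + b m                ≡⟨ b-m ⟩
      2 * K + 2 * h m          ≡⟨ cong (_+ 2 * h m) (b-X v∈X fv gv) ⟨
      s v + b v + 2 * h m      ≡⟨ cong (λ t → s v + t + 2 * h m) eq ⟨
      s v + b m + 2 * h m      ≡⟨ x+y+z≡x+z+y (s v) (b m) (2 * h m) ⟩
      s v + 2 * h m + b m      ∎))
      where open ≡-Reasoning

    -- The outer vertex has blue degree 2. If `m` had the same, then `s m < 2 * K` and `1 ≤ h m`
    -- would make the total in `b-m` too small.
    blue-m-Y : ∀ {v} → X v ≡ false → f v ≡ 0 → g v ≡ 1 → m ~ v → b m ≢ b v
    blue-m-Y {v} v∉X fv gv m~v eq = <⇒≢ (begin-strict
      s m + b m           ≡⟨ cong (s m +_) (trans eq (trans (b-Y v∉X fv gv)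
                               (cong (2 *_) (A-yes (~-sym m~v))))) ⟩
      s m + 2             <⟨ +-monoˡ-< 2 s-m< ⟩
      2 * K + 2 * 1       ≤⟨ +-monoʳ-≤ (2 * K) (*-monoʳ-≤ 2 (h>0 v∉X m~v)) ⟩
      2 * K + 2 * h m     ∎) b-m
      where open ≤-Reasoning

    blue-X-X : ∀ {u v} → X u ≡ true → X v ≡ true → m ≢ u → m ≢ v → f u ≡ 1 → f v ≡ 1 → g u ≡ 0 → g v ≡ 0 →
      u ≢ v → w u v < 2 → b u ≢ b v
    blue-X-X {u} {v} u∈X v∈X m≢u m≢v fu fv gu gv u≢v w<2 eq =
      blue u∈X v∈X (≢-sym m≢u) (≢-sym m≢v) u≢v w<2 (+-cancelʳ-≡ (b u) _ _ (begin
        s u + b u    ≡⟨ b-X u∈X fu gu ⟩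
        2 * K        ≡⟨ b-X v∈X fv gv ⟨
        s v + b v    ≡⟨ cong (s v +_) eq ⟨
        s v + b u    ∎))
      where open ≡-Reasoning

    B-cross : ∀ {u v} → X u ≡ false → f u ≡ 0 → g u ≡ 1 → f v ≡ 1 → B u v ≡ 0
    B-cross {u} {v} u∉X fu gu fv = m≤n⇒m∸n≡0 (≤-reflexive (sym (R-cross u∉X fu gu fv)))

    B-irregular : ∀ u v → 0 < B u v → b u ≢ b v
    B-irregular u v B>0 with part u | part v
    ... | is-m refl _ _ _    | is-m refl _ _ _    = contradiction (B>0⇒~ u v B>0) (~-irrefl u)
    ... | is-m refl _ fu gu  | in-X m≢v v∈X fv gv = blue-m-X m≢v v∈X fv gv
      (subst (_< 2) (R-clique gu gv) (B>0⇒R<2 u v B>0))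
    ... | in-X m≢u u∈X fu gu | is-m refl _ fv gv  = ≢-sym (blue-m-X m≢u u∈X fu gu
      (subst (_< 2) (trans (R-sym u v) (R-clique gv gu)) (B>0⇒R<2 u v B>0)))
    ... | in-X m≢u u∈X fu gu | in-X m≢v v∈X fv gv = blue-X-X u∈X v∈X m≢u m≢v fu fv gu gv
      (~⇒≢ (B>0⇒~ u v B>0)) (subst (_< 2) (R-clique gu gv) (B>0⇒R<2 u v B>0))
    ... | is-m refl _ _ _    | in-Y _ v∉X fv gv   = blue-m-Y v∉X fv gv (B>0⇒~ u v B>0)
    ... | in-Y _ u∉X fu gu   | is-m refl _ _ _    = ≢-sym (blue-m-Y u∉X fu gu (~-sym (B>0⇒~ u v B>0)))
    ... | in-Y _ u∉X fu gu   | in-X _ _ fv _      = contradiction (B-cross u∉X fu gu fv) (≢-sym (<⇒≢ B>0))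
    ... | in-X _ _ fu _      | in-Y _ v∉X fv gv   =
      contradiction (trans (B-sym u v) (B-cross v∉X fv gv fu)) (≢-sym (<⇒≢ B>0))
    ... | in-Y _ u∉X _ _     | in-Y _ v∉X _ _     = contradiction (B>0⇒~ u v B>0) (independent u∉X v∉X)

    seed⇒lir : lir (² G) ≤ 2
    seed⇒lir = lir≤2 (² G) R B R-sym (λ u v → trans (R+B≡2A u v) (2A≡mult u v)) R-irregular B-irregular

  -- Stars.

  -- Every edge joins `z` to a vertex of degree 1. Colouring everything red therefore works unless
  -- `z` has degree 1 as well, and then connectedness leaves only `K₂`.
  star-lir : Connected G → ¬ (G ≅ K₂) → ∀ z → (∀ {u v} → u ~ v → z ≡ u ⊎ z ≡ v) → lir (² G) ≤ 2
  star-lir connected G≇K₂ z centre = lir≤2 (² G) (λ u v → 2 * A u v) (λ _ _ → 0)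
    (λ u v → cong (2 *_) (A-sym u v)) (λ u v → trans (+-identityʳ _) (2A≡mult u v))
    (λ u v 2A>0 → irregular (A>0⇒~ (*-cancelˡ-< 2 0 (A u v) 2A>0))) (λ _ _ ())
    where
    d : Fin n → ℕ
    d u = sum (A u)

    leaf-degree : ∀ {v} → z ≢ v → d v ≤ 1
    leaf-degree {v} z≢v = subst (d v ≤_) (sum-δ z) (sum-≤ A≤δ)
      where
      A≤δ : ∀ u → A v u ≤ δ z u
      A≤δ u with v ~? u
      ... | no _ = z≤n
      ... | yes v~u with centre v~u
      ...   | inj₁ z≡v  = contradiction z≡v z≢v
      ...   | inj₂ refl = ≤-reflexive (sym (δ-refl z))

    -- A walk from `z` can only alternate between `z` and `v`, so by connectedness there are no
    -- other vertices.
    only-edge : ∀ {v} → z ~ v → (∀ u → z ~ u → u ≡ v) → G ≅ K₂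
    only-edge {v} z~v neighbour = mk↔ₛ′ to from to-from from-to , λ x y → mk⇔ (forth x y) (back x y)
      where
      z≢v : z ≢ v
      z≢v refl = ~-irrefl z z~v

      reach : ∀ {x y} → Star _~_ x y → x ≡ z ⊎ x ≡ v → y ≡ z ⊎ y ≡ v
      reach ε             x∈         = x∈
      reach (x~y ◅ walk) (inj₁ refl) = reach walk (inj₂ (neighbour _ x~y))
      reach (x~y ◅ walk) (inj₂ refl) with centre x~y
      ... | inj₁ refl = contradiction refl z≢v
      ... | inj₂ refl = reach walk (inj₁ refl)

      vertices : ∀ x → x ≡ z ⊎ x ≡ v
      vertices x = reach (connected z x) (inj₁ refl)

      to : Fin n → Fin 2
      to x = if does (z ≟ x) then zero else suc zero

      from : Fin 2 → Fin n
      from zero       = z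
      from (suc zero) = v

      to-z : to z ≡ zero
      to-z = cong (λ t → if t then zero else suc zero) (dec-true (z ≟ z) refl)

      to-v : to v ≡ suc zero
      to-v = cong (λ t → if t then zero else suc zero) (dec-false (z ≟ v) z≢v)

      to-from : ∀ i → to (from i) ≡ i
      to-from zero       = to-z
      to-from (suc zero) = to-v

      from-to : ∀ x → from (to x) ≡ x
      from-to x with vertices x
      ... | inj₁ refl = cong from to-z
      ... | inj₂ refl = cong from to-v

      forth : ∀ x y → x ~ y → to x ≢ to y
      forth x y x~y eq = ~-irrefl y
        (subst (_~ y) (trans (sym (from-to x)) (trans (cong from eq) (from-to y))) x~y)

      back : ∀ x y → to x ≢ to y → x ~ y
      back x y to≢ with vertices x | vertices y
      ... | inj₁ refl | inj₂ refl = z~v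
      ... | inj₂ refl | inj₁ refl = ~-sym z~v
      ... | inj₁ refl | inj₁ refl = contradiction refl to≢
      ... | inj₂ refl | inj₂ refl = contradiction refl to≢

    d< : ∀ {v} → z ~ v → d v < d z
    d< {v} z~v with any? (λ u → (z ~? u) ×-dec ¬? (u ≟ v))
    -- A second neighbour `u` gives `z` degree at least 2, while the leaf `v` has degree at most 1.
    ... | yes (u , z~u , u≢v) = ≤-trans (s≤s (leaf-degree λ { refl → ~-irrefl z z~v }))
      (subst (_≤ d z) (cong₂ _+_ (A-yes z~u) (A-yes z~v)) (two-terms≤sum (A z) u≢v))
    ... | no ∄ = contradiction (only-edge z~v neighbour) G≇K₂
      where
      neighbour : ∀ u → z ~ u → u ≡ v
      neighbour u z~u with u ≟ v
      ... | yes u≡v = u≡v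
      ... | no u≢v  = contradiction (u , z~u , u≢v) ∄

    irregular : ∀ {u v} → u ~ v → sum (λ x → 2 * A u x) ≢ sum (λ x → 2 * A v x)
    irregular {u} {v} u~v eq = d≢ (*-cancelˡ-≡ (d u) (d v) 2
      (trans (*-distribˡ-sum 2 (A u)) (trans eq (sym (*-distribˡ-sum 2 (A v))))))
      where
      d≢ : d u ≢ d v
      d≢ with centre u~v
      ... | inj₁ refl = ≢-sym (<⇒≢ (d< u~v))
      ... | inj₂ refl = <⇒≢ (d< (~-sym u~v))

-- The cases by the size of the clique.

halve : ∀ i → ∃[ j ] (i ≡ 2 * j ⊎ i ≡ suc (2 * j))
halve zero    = 0 , inj₁ refl
halve (suc i) with halve i
... | j , inj₁ i≡2j   = j , inj₂ (cong suc i≡2j)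
... | j , inj₂ i≡1+2j = suc j , inj₁ (trans (cong suc i≡1+2j) (sym (*-suc 2 j)))

theorem8 : ∀ {n} (G : SimpleGraph n) →
    IsSplit G → Connected G → ¬ (G ≅ K₂) → lir (² G) ≤ 2
theorem8 {n} G (p , p-clique , ∁p-independent) connected G≇K₂ = by-size (size X) refl
  where
  open SimpleGraph G using (_~_; ~-sym; ~-irrefl; nonempty)

  X : Fin n → Bool
  X = Vec.lookup p

  clique : ∀ {u v} → X u ≡ true → X v ≡ true → u ≢ v → u ~ v
  clique {u} {v} u∈X v∈X = p-clique u v (lookup⇒[]= u p u∈X) (lookup⇒[]= v p v∈X)

  independent : ∀ {u v} → X u ≡ false → X v ≡ false → ¬ u ~ v
  independent {u} {v} u∉X v∉X = ∁p-independent u v (∈∁ u∉X) (∈∁ v∉X)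
    where
    ∈∁ : ∀ {x} → X x ≡ false → _
    ∈∁ x∉X = x∉p⇒x∈∁p λ x∈p → contradiction (trans (sym x∉X) ([]=⇒lookup x∈p)) λ ()

  h : Fin n → ℕ
  h u = sum (λ v → A G u v * ⟦ not (X v) ⟧)

  seeded : ∀ {K} → size X ≡ suc K → Seed X h K → lir (² G) ≤ 2
  seeded |X|≡1+K seed = FromSeed.seed⇒lir G X clique independent |X|≡1+K seed

  -- Since the complement of `X` is independent, every edge has an end in `X`, and up to swapping
  -- its ends that end comes first.
  starred : ∀ z → (∀ {u v} → X u ≡ true → u ~ v → z ≡ u ⊎ z ≡ v) → lir (² G) ≤ 2
  starred z centre = star-lir G connected G≇K₂ z centre′
    where
    centre′ : ∀ {u v} → u ~ v → z ≡ u ⊎ z ≡ v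
    centre′ {u} {v} u~v with X u in u∈X | X v in v∈X
    ... | true  | _     = centre u∈X u~v
    ... | false | true  = ⊎-swap (centre v∈X (~-sym u~v))
    ... | false | false = contradiction u~v (independent u∈X v∈X)

  vertex : ∀ {k} → NonZero k → Fin k
  vertex {suc _} _ = zero

  by-size : ∀ k → size X ≡ k → lir (² G) ≤ 2
  -- With `X` empty there are no edges, so any vertex can serve as the centre.
  by-size 0 |X|≡0 = starred (vertex nonempty) λ {u} u∈X _ →
    contradiction (subst₂ _≤_ (cong ⟦_⟧ u∈X) |X|≡0 (term≤sum (λ v → ⟦ X v ⟧) u)) λ ()
  by-size 1 |X|≡1 = let z , z∈X = member {X = X} |X|≡1 in
    starred z λ u∈X _ → inj₁ (singleton-unique {X = X} |X|≡1 z∈X u∈X)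
  by-size 2 |X|≡2 with any? (λ u → (X u ≟ᵇ true) ×-dec (h u ≟ⁿ 0))
  ... | no ∄ = seeded |X|≡2 (pairSeed h |X|≡2 λ {u} u∈X → n≢0⇒n>0 λ hu≡0 → ∄ (u , u∈X , hu≡0))
  -- As `u` has no neighbour outside `X`, it can only be adjacent to the other clique vertex `z`,
  -- which therefore meets every edge.
  ... | yes (u , u∈X , hu≡0) = starred z centre
    where
    open Without {X = X} u∈X

    |X∖u| : size X° ≡ 1
    |X∖u| = suc-injective (trans (sym size-without) |X|≡2)

    z = proj₁ (member {X = X°} |X∖u|)

    z≡ : ∀ {v} → X v ≡ true → u ≢ v → z ≡ v
    z≡ v∈X u≢v = singleton-unique {X = X°} |X∖u| (proj₂ (member {X = X°} |X∖u|)) (without⁺ v∈X u≢v)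

    u~⇒∈X : ∀ {v} → u ~ v → X v ≡ true
    u~⇒∈X {v} u~v with X v in v∈X
    ... | true  = refl
    ... | false = contradiction
      (subst₂ _≤_ (cong₂ _*_ (A-yes G u~v) (cong (⟦_⟧ ∘ not) v∈X)) hu≡0
        (term≤sum (λ v → A G u v * ⟦ not (X v) ⟧) v)) λ ()

    centre : ∀ {v x} → X v ≡ true → v ~ x → z ≡ v ⊎ z ≡ x
    centre {v} {x} v∈X v~x with u ≟ v
    ... | no u≢v   = inj₁ (z≡ v∈X u≢v)
    ... | yes refl = inj₂ (z≡ (u~⇒∈X v~x) λ { refl → ~-irrefl u v~x })
  by-size (suc (suc (suc i))) |X|≡3+i with halve i
  -- The size `3 + 2 * j` is regrouped as `1 + 2 * suc j`, which displays the `suc j` peeling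
  -- rounds.
  ... | j , inj₁ refl = seeded |X|≡ (oddSeed h j |X|≡)
    where
    |X|≡ : size X ≡ suc (2 * suc j)
    |X|≡ = trans |X|≡3+i (cong suc (sym (*-suc 2 j)))
  ... | j , inj₂ refl = seeded |X|≡ (evenSeed h j |X|≡)
    where
    |X|≡ : size X ≡ suc (suc (2 * suc j))
    |X|≡ = trans |X|≡3+i (cong (2 +_) (sym (*-suc 2 j)))
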